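{- Dirichlet's theorem on primes in arithmetic progressions (that is, the assertion that for all coprime integers $a$ and $b\ge1$ the progression $\{a+bk:k\in\mathbb N\}$ contains infinitely many prime numbers) holds if and only if $$\hat{\mathcal P}=\mathcal P\cup\hat{\mathbb Z}^*$$ is true, where $\hat{\mathcal P}$ is the closure of the set $\mathcal P$ of prime numbers in $\hat{\mathbb Z}$.
   Context: $\mathbb N=\{0,1,2,\dots\}$; $\mathcal P\subset\mathbb N$ is the set of prime numbers. $\hat{\mathbb Z}=\varprojlim_n\mathbb Z/n\mathbb Z$ is the profinite completion of $\mathbb Z$, with the profinite topology (the subspace topology from $\prod_{n\ge1}\mathbb Z/n\mathbb Z$, each factor being discrete), and $\hat{\mathbb Z}^*$ is its group of units. $\mathbb Z$ is identified with its image in $\hat{\mathbb Z}$ under the natural injection $x\mapsto(x\bmod n)_n$, so that $\mathcal P\subset\mathbb Z\subset\hat{\mathbb Z}$. -}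

module Defs where

open import Data.Integer.Base using (ℤ; +_; _+_; _-_; _≤_; 0ℤ; 1ℤ)
  renaming (_*_ to _*ℤ_)
open import Data.Integer.Coprimality using (Coprime)
open import Data.Integer.Divisibility.Signed using (∣m∣n⇒∣m+n; ∣n⇒∣m*n; ∣m⇒∣m*n; divides)
  renaming (_∣_ to _∣ℤ_)
open import Data.Integer.Properties using (+-inverseʳ)
open import Data.Integer.Tactic.RingSolver using (solve-∀)
open import Data.List.Base using (List)
import Data.List.Membership.Propositional as List
open import Data.Nat.Base using (ℕ; NonZero)
open import Data.Nat.Divisibility using (_∣_)
open import Data.Nat.Primality using (Prime)
open import Data.Product.Base using (∃; _×_)
open import Level using (Level; 0ℓ) renaming (suc to lsuc)
open import Relation.Binary.PropositionalEquality using (_≡_; subst)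
open import Relation.Nullary using (¬_)
open import Relation.Unary using (Pred; _∈_; _⊆_; _≐_; _≬_; _⊢_)
import Algebra.Definitions as Alg

private
  variable
    a ℓ : Level
    A : Set a

Finite : Pred A ℓ → Set _
Finite P = ∃ λ xs → P ⊆ (λ x → x List.∈ xs)

Infinite : Pred A ℓ → Set _
Infinite P = ¬ Finite P

DirichletTheorem : Set
DirichletTheorem =
  ∀ (a b : ℤ) → 1ℤ ≤ b → Coprime a b →
  Infinite (λ (p : ℕ) → Prime p × ∃ λ (k : ℕ) → + p ≡ a + b *ℤ + k)

-- The ring ℤ/nℤ is the setoid of integers under congruence modulo n.

infix 4 _≡_[mod_]

_≡_[mod_] : ℤ → ℤ → ℕ → Set
x ≡ y [mod n ] = + n ∣ℤ (x - y)

≡-mod-refl : ∀ {n} x → x ≡ x [mod n ]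
≡-mod-refl x = divides 0ℤ (+-inverseʳ x)

*-cong-mod : ∀ {n} x x′ y y′ → x ≡ x′ [mod n ] → y ≡ y′ [mod n ] →
             x *ℤ y ≡ x′ *ℤ y′ [mod n ]
*-cong-mod {n} x x′ y y′ p q =
  subst (+ n ∣ℤ_) (identity x x′ y y′)
    (∣m∣n⇒∣m+n (∣n⇒∣m*n x q) (∣m⇒∣m*n y′ p))
  where
  identity : ∀ x x′ y y′ →
             x *ℤ (y - y′) + (x - x′) *ℤ y′ ≡ x *ℤ y - x′ *ℤ y′
  identity = solve-∀

-- A family gives a representative of a class in ℤ/nℤ for every n ≥ 1; two
-- families are the same point of ∏ₙ ℤ/nℤ when they are congruent at every n.

∏ℤ/ : Set
∏ℤ/ = (n : ℕ) .{{_ : NonZero n}} → ℤ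

record Ẑ : Set where
  constructor mkẐ
  field
    seq        : ∏ℤ/
    compatible : ∀ {m n} .{{_ : NonZero m}} .{{_ : NonZero n}} →
                 m ∣ n → seq n ≡ seq m [mod m ]

open Ẑ public

infix 4 _≈_

_≈_ : Ẑ → Ẑ → Set
x ≈ y = ∀ n .{{_ : NonZero n}} → seq x n ≡ seq y n [mod n ]

ι : ℤ → Ẑ
ι x = mkẐ (λ _ → x) (λ _ → ≡-mod-refl x)

infixl 7 _*_

_*_ : Ẑ → Ẑ → Ẑ
x * y = mkẐ (λ n → seq x n *ℤ seq y n)
  (λ {m} {n} m∣n → *-cong-mod (seq x n) (seq x m) (seq y n) (seq y m)
                     (compatible x m∣n) (compatible y m∣n))

Ẑ* : Pred Ẑ 0ℓ
Ẑ* x = Alg.Invertible _≈_ (ι 1ℤ) _*_ x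

𝒫 : Pred Ẑ 0ℓ
𝒫 x = ∃ λ (p : ℕ) → Prime p × x ≈ ι (+ p)

-- Product topology with discrete factors: every point of V has a basic
-- neighbourhood inside V, obtained by fixing finitely many coordinates.  Such a
-- V automatically respects equality of points of ∏ₙ ℤ/nℤ.

∏-Open : Pred ∏ℤ/ 0ℓ → Set
∏-Open V = ∀ f → f ∈ V → ∃ λ (F : List ℕ) →
  ∀ g → (∀ n .{{_ : NonZero n}} → n List.∈ F → f n ≡ g n [mod n ]) → g ∈ V

Ẑ-Open : Pred Ẑ 0ℓ → Set (lsuc 0ℓ)
Ẑ-Open U = ∃ λ (V : Pred ∏ℤ/ 0ℓ) → ∏-Open V × U ≐ (seq ⊢ V)

-- The basic open sets live at level 0ℓ, so quantifying over opens at that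
-- level loses nothing.

closure : Pred Ẑ 0ℓ → Pred Ẑ (lsuc 0ℓ)
closure S x = ∀ (U : Pred Ẑ 0ℓ) → Ẑ-Open U → x ∈ U → S ≬ U

{-# OPTIONS --safe #-}
module Submission where

-- A point x of the closure that is not a unit has p ∣ x for some prime p; a
-- prime close to x modulo np is then divisible by p, so it is p, and x ≡ p
-- modulo every n.  Units correspond to compatible families of reduced residue
-- classes, so Dirichlet's theorem puts a prime into every neighbourhood of a
-- unit.  Conversely, a class a mod b with a coprime to b lifts to a unit of Ẑ,
-- and primes close enough to that unit are arbitrarily large and ≡ a mod b.

open import Defs
open import Axiom.DoubleNegationElimination using (em⇒dne)
open import Axiom.ExcludedMiddle using (ExcludedMiddle)
open import Data.Empty using (⊥-elim)
open import Data.Fin.Base using (toℕ; fromℕ<)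
open import Data.Fin.Properties using (pigeonhole; toℕ≤pred[n]; fromℕ<-injective)
open import Data.Integer.Base
  using (ℤ; +_; -_; _+_; _-_; _^_; _≤_; +≤+; -≤+; -[1+_]; ∣_∣; 0ℤ; 1ℤ)
  renaming (_*_ to _*ℤ_)
open import Data.Integer.Coprimality using (Coprime; coprime-divisor)
import Data.Integer.Coprimality as Coprimality using (sym)
open import Data.Integer.DivMod using (_%ℕ_; _/ℕ_; n%ℕd<d; a≡a%ℕn+[a/ℕn]*n)
open import Data.Integer.Divisibility.Signed
  using (∣m∣n⇒∣m+n; ∣m⇒∣-m; ∣m⇒∣m*n; ∣n⇒∣m*n; ∣ᵤ⇒∣; ∣⇒∣ᵤ; ∣-trans; divides)
  renaming (_∣_ to _∣ℤ_)
import Data.Integer.Properties as ℤ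
open import Data.Integer.Tactic.RingSolver using (solve-∀)
open import Data.List.Base using ([]; _∷_)
import Data.List.Membership.Propositional as List
open import Data.List.Relation.Unary.All using (_∷_)
open import Data.List.Relation.Unary.Any using (here; there)
open import Data.Nat.Base as ℕ using (ℕ; NonZero; NonTrivial; _!; _∸_)
open import Data.Nat.Divisibility using (_∣_; m∣m*n; n∣m*n; m≤n⇒m!∣n!; ∣⇒≤; ∣1⇒≡1)
import Data.Nat.Divisibility as ℕ using (divides; ∣-trans; ∣-refl; _∣?_)
open import Data.Nat.ListAction using (sum; product)
open import Data.Nat.Primality
  using (Prime; prime⇒nonZero; prime⇒nonTrivial; prime⇒irreducible)
open import Data.Nat.Primality.Factorisation using (factorise)
import Data.Nat.Properties as ℕ
open import Data.Product.Base using (∃; ∃₂; Σ; _×_; _,_; proj₂)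
open import Data.Sum.Base using (inj₁; inj₂)
open import Function.Bundles using (_⇔_; mk⇔)
open import Level using (0ℓ)
open import Relation.Binary.Bundles using (Setoid)
open import Relation.Binary.PropositionalEquality
  using (_≡_; _≢_; refl; sym; trans; cong; cong₂; subst; module ≡-Reasoning)
import Relation.Binary.Reasoning.Setoid as SetoidReasoning
open import Relation.Nullary using (¬_; yes; no)
open import Relation.Unary using (_≐_; _∪_; Pred; _∈_; _⊢_)

-- Congruences of integers.

i+j-i≡j : ∀ i j → i + j - i ≡ j
i+j-i≡j = solve-∀

≡⇒≡-mod : ∀ {n x y} → x ≡ y → x ≡ y [mod n ]
≡⇒≡-mod {x = x} refl = ≡-mod-refl x

≡-mod-sym : ∀ {n} x y → x ≡ y [mod n ] → y ≡ x [mod n ]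
≡-mod-sym {n} x y p = subst (+ n ∣ℤ_) (identity x y) (∣m⇒∣-m p)
  where
  identity : ∀ x y → - (x - y) ≡ y - x
  identity = solve-∀

≡-mod-trans : ∀ {n} x y z → x ≡ y [mod n ] → y ≡ z [mod n ] → x ≡ z [mod n ]
≡-mod-trans {n} x y z p q = subst (+ n ∣ℤ_) (identity x y z) (∣m∣n⇒∣m+n p q)
  where
  identity : ∀ x y z → (x - y) + (y - z) ≡ x - z
  identity = solve-∀

≡-mod-setoid : ℕ → Setoid 0ℓ 0ℓ
≡-mod-setoid n = record
  { Carrier       = ℤ
  ; _≈_           = _≡_[mod n ]
  ; isEquivalence = record
    { refl  = λ {x} → ≡-mod-refl x
    ; sym   = λ {x} {y} → ≡-mod-sym x y
    ; trans = λ {x} {y} {z} → ≡-mod-trans x y z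
    }
  }

module ≡-mod-Reasoning (n : ℕ) = SetoidReasoning (≡-mod-setoid n)

≡-mod-∣ : ∀ {m n} x y → m ∣ n → x ≡ y [mod n ] → x ≡ y [mod m ]
≡-mod-∣ x y m∣n = ∣-trans (∣ᵤ⇒∣ m∣n)

+-cong-mod : ∀ {n} x x′ y y′ → x ≡ x′ [mod n ] → y ≡ y′ [mod n ] →
             x + y ≡ x′ + y′ [mod n ]
+-cong-mod {n} x x′ y y′ p q =
  subst (+ n ∣ℤ_) (identity x x′ y y′) (∣m∣n⇒∣m+n p q)
  where
  identity : ∀ x x′ y y′ → (x - x′) + (y - y′) ≡ (x + y) - (x′ + y′)
  identity = solve-∀

*-congˡ-mod : ∀ {n} x y y′ → y ≡ y′ [mod n ] → x *ℤ y ≡ x *ℤ y′ [mod n ]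
*-congˡ-mod x y y′ = *-cong-mod x x y y′ (≡-mod-refl x)

*-congʳ-mod : ∀ {n} y x x′ → x ≡ x′ [mod n ] → x *ℤ y ≡ x′ *ℤ y [mod n ]
*-congʳ-mod y x x′ p = *-cong-mod x x′ y y p (≡-mod-refl y)

∣-resp-≡-mod : ∀ {n} x y → x ≡ y [mod n ] → + n ∣ℤ x → + n ∣ℤ y
∣-resp-≡-mod {n} x y p n∣x =
  subst (+ n ∣ℤ_) (identity x y) (∣m∣n⇒∣m+n n∣x (≡-mod-sym x y p))
  where
  identity : ∀ x y → x + (y - x) ≡ y
  identity = solve-∀

%ℕ≡⇒≡-mod : ∀ x y n .{{_ : NonZero n}} → x %ℕ n ≡ y %ℕ n → x ≡ y [mod n ]
%ℕ≡⇒≡-mod x y n eq = divides (x /ℕ n - y /ℕ n) (begin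
  x - y
    ≡⟨ cong₂ _-_ (a≡a%ℕn+[a/ℕn]*n x n) (a≡a%ℕn+[a/ℕn]*n y n) ⟩
  (+ (x %ℕ n) + x /ℕ n *ℤ + n) - (+ (y %ℕ n) + y /ℕ n *ℤ + n)
    ≡⟨ cong (λ r → (+ r + x /ℕ n *ℤ + n) - (+ (y %ℕ n) + y /ℕ n *ℤ + n)) eq ⟩
  (+ (y %ℕ n) + x /ℕ n *ℤ + n) - (+ (y %ℕ n) + y /ℕ n *ℤ + n)
    ≡⟨ identity (+ (y %ℕ n)) (x /ℕ n) (y /ℕ n) (+ n) ⟩
  (x /ℕ n - y /ℕ n) *ℤ + n ∎)
  where
  open ≡-Reasoning
  identity : ∀ r u v n → (r + u *ℤ n) - (r + v *ℤ n) ≡ (u - v) *ℤ n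
  identity = solve-∀

-- Factorials as common multiples, and prime divisors.

m≤n⇒m∣n! : ∀ {m n} .{{_ : NonZero m}} → m ℕ.≤ n → m ∣ n !
m≤n⇒m∣n! {ℕ.suc m} m≤n = ℕ.∣-trans (m∣m*n (m !)) (m≤n⇒m!∣n! m≤n)

∈⇒≤sum : ∀ {n ns} → n List.∈ ns → n ℕ.≤ sum ns
∈⇒≤sum {ns = n ∷ ns} (here refl)  = ℕ.m≤m+n n (sum ns)
∈⇒≤sum {ns = m ∷ ns} (there n∈ns) = ℕ.≤-trans (∈⇒≤sum n∈ns) (ℕ.m≤n+m (sum ns) m)

-- A list may contain 0, which would make `product ns` vanish; `sum ns !` is a common multiple of
-- the nonzero entries that is never 0.
∈⇒∣sum! : ∀ {n ns} .{{_ : NonZero n}} → n List.∈ ns → n ∣ sum ns !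
∈⇒∣sum! n∈ns = m≤n⇒m∣n! (∈⇒≤sum n∈ns)

prime⇒≢1 : ∀ {p} → Prime p → p ≢ 1
prime⇒≢1 pp = ℕ.nonTrivial⇒≢1 {{prime⇒nonTrivial pp}}

prime-divisor : ∀ n .{{_ : NonTrivial n}} → ∃ λ p → Prime p × p ∣ n
prime-divisor n@(ℕ.2+ _) with factorise n
... | record { factors = [] ; isFactorisation = () }
... | record { factors = p ∷ ps ; isFactorisation = eq ; factorsPrime = pp ∷ _ } =
  p , pp , subst (p ∣_) (sym eq) (m∣m*n (product ps))

-- Powers with factorial exponents modulo `m`.

module Powers (b : ℤ) (m : ℕ) .{{_ : NonZero m}} where

  open ≡-mod-Reasoning m

  -- The `m + 1` powers with exponents 0 to `m` leave at most `m` different remainders.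
  ^-collision : ∃₂ λ i j → i ℕ.< j × j ℕ.≤ m × b ^ i ≡ b ^ j [mod m ]
  ^-collision with pigeonhole (ℕ.n<1+n m) (λ i → fromℕ< (n%ℕd<d (b ^ toℕ i) m))
  ... | i , j , i<j , eq =
    toℕ i , toℕ j , i<j , toℕ≤pred[n] j ,
    %ℕ≡⇒≡-mod (b ^ toℕ i) (b ^ toℕ j) m (fromℕ<-injective _ _ _ _ eq)

  ^-+-period : ∀ {d i} → b ^ i ≡ b ^ (i ℕ.+ d) [mod m ] →
               ∀ {e} → i ℕ.≤ e → b ^ (e ℕ.+ d) ≡ b ^ e [mod m ]
  ^-+-period {d} {i} eq {e} i≤e = begin
    b ^ (e ℕ.+ d)            ≡⟨ cong (λ k → b ^ (k ℕ.+ d)) e≡r+i ⟩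
    b ^ (r ℕ.+ i ℕ.+ d)      ≡⟨ cong (b ^_) (ℕ.+-assoc r i d) ⟩
    b ^ (r ℕ.+ (i ℕ.+ d))    ≡⟨ ℤ.^-distribˡ-+-* b r (i ℕ.+ d) ⟩
    b ^ r *ℤ b ^ (i ℕ.+ d)   ≈⟨ *-congˡ-mod (b ^ r) (b ^ i) (b ^ (i ℕ.+ d)) eq ⟨
    b ^ r *ℤ b ^ i           ≡⟨ ℤ.^-distribˡ-+-* b r i ⟨
    b ^ (r ℕ.+ i)            ≡⟨ cong (b ^_) e≡r+i ⟨
    b ^ e                    ∎
    where
    r : ℕ
    r = e ∸ i

    e≡r+i : e ≡ r ℕ.+ i
    e≡r+i = sym (ℕ.m∸n+n≡m i≤e)

  ^-+-*-period : ∀ {d i} → b ^ i ≡ b ^ (i ℕ.+ d) [mod m ] →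
                 ∀ {e} → i ℕ.≤ e → ∀ q → b ^ (e ℕ.+ q ℕ.* d) ≡ b ^ e [mod m ]
  ^-+-*-period eq {e} i≤e ℕ.zero = ≡⇒≡-mod (cong (b ^_) (ℕ.+-identityʳ e))
  ^-+-*-period {d} eq {e} i≤e (ℕ.suc q) = begin
    b ^ (e ℕ.+ (d ℕ.+ q ℕ.* d))
      ≡⟨ cong (b ^_) (ℕ.+-assoc e d (q ℕ.* d)) ⟨
    b ^ (e ℕ.+ d ℕ.+ q ℕ.* d)
      ≈⟨ ^-+-*-period eq (ℕ.≤-trans i≤e (ℕ.m≤m+n e d)) q ⟩
    b ^ (e ℕ.+ d)
      ≈⟨ ^-+-period eq i≤e ⟩
    b ^ e ∎

  -- A collision at `i < j ≤ m` gives the period `j ∸ i` from exponent `i` on. The period is between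
  -- 1 and `m`, so it divides `m !` and hence `t`; the bound `m ≤ e` puts `e` past the preperiod.
  ^-+-!-period : ∀ {e t} → m ℕ.≤ e → m ! ∣ t → b ^ (e ℕ.+ t) ≡ b ^ e [mod m ]
  ^-+-!-period {e} {t} m≤e m!∣t with ^-collision
  ... | i , j , i<j , j≤m , eq with ℕ.∣-trans (m≤n⇒m∣n! {j ∸ i} j∸i≤m) m!∣t
    where
    instance
      j∸i≢0 : NonZero (j ∸ i)
      j∸i≢0 = ℕ.>-nonZero (ℕ.m<n⇒0<n∸m i<j)

    j∸i≤m : j ∸ i ℕ.≤ m
    j∸i≤m = ℕ.≤-trans (ℕ.m∸n≤m j i) j≤m
  ... | ℕ.divides q refl =
    ^-+-*-period
      (subst (λ k → b ^ i ≡ b ^ k [mod m ]) (sym (ℕ.m+[n∸m]≡n (ℕ.<⇒≤ i<j))) eq)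
      (ℕ.≤-trans (ℕ.≤-trans (ℕ.<⇒≤ i<j) j≤m) m≤e) q

  -- `n !` is a positive multiple of `m !`, thus `m !` plus a multiple of `m !`, and `m ≤ m !` is
  -- past the preperiod. This makes `b ^ (n !)` a compatible family in `n`.
  ^!-stable : ∀ {n} .{{_ : NonZero n}} → m ∣ n → b ^ (n !) ≡ b ^ (m !) [mod m ]
  ^!-stable {n} m∣n with m≤n⇒m!∣n! (∣⇒≤ m∣n)
  ... | ℕ.divides ℕ.zero eq = ⊥-elim (ℕ.≢-nonZero⁻¹ (n !) {{n ℕ.!≢0}} eq)
  ... | ℕ.divides (ℕ.suc q) eq =
    subst (λ k → b ^ k ≡ b ^ (m !) [mod m ]) (sym eq)
      (^-+-!-period (∣⇒≤ {{m ℕ.!≢0}} (m≤n⇒m∣n! ℕ.≤-refl)) (n∣m*n q))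

  ∣^*⇒∣ : Coprime b (+ m) → ∀ e z → + m ∣ℤ b ^ e *ℤ z → + m ∣ℤ z
  ∣^*⇒∣ c ℕ.zero    z m∣z  = subst (+ m ∣ℤ_) (ℤ.*-identityˡ z) m∣z
  ∣^*⇒∣ c (ℕ.suc e) z m∣bz = ∣^*⇒∣ c e z (∣ᵤ⇒∣
    (coprime-divisor (+ m) b (b ^ e *ℤ z) (Coprimality.sym {b} {+ m} c)
      (∣⇒∣ᵤ (subst (+ m ∣ℤ_) (ℤ.*-assoc b (b ^ e) z) m∣bz))))

  -- A form of Euler's theorem with `m !` in place of the totient: cancel `b ^ m` from the
  -- congruence of `b ^ (m + m !)` and `b ^ m`.
  coprime⇒^!≡1 : Coprime b (+ m) → b ^ (m !) ≡ 1ℤ [mod m ]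
  coprime⇒^!≡1 c = ∣^*⇒∣ c m (b ^ (m !) - 1ℤ)
    (subst (+ m ∣ℤ_) eq (^-+-!-period {m} {m !} ℕ.≤-refl ℕ.∣-refl))
    where
    identity : ∀ x y → x *ℤ y - x ≡ x *ℤ (y - 1ℤ)
    identity = solve-∀

    eq : b ^ (m ℕ.+ m !) - b ^ m ≡ b ^ m *ℤ (b ^ (m !) - 1ℤ)
    eq = trans (cong (_- b ^ m) (ℤ.^-distribˡ-+-* b m (m !))) (identity (b ^ m) (b ^ (m !)))

open Powers using (^!-stable; coprime⇒^!≡1)

-- Units of `Ẑ`, and residue classes lifted to them.

unit⇒coprime : ∀ {x} → x ∈ Ẑ* → ∀ n .{{_ : NonZero n}} → Coprime (seq x n) (+ n)
unit⇒coprime {x} (y , yx≈1 , _) n {d} (d∣x , d∣n) = ∣1⇒≡1 (∣⇒∣ᵤ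
  (∣-resp-≡-mod (seq y n *ℤ seq x n) 1ℤ
    (≡-mod-∣ (seq y n *ℤ seq x n) 1ℤ d∣n (yx≈1 n))
    (∣n⇒∣m*n (seq y n) (∣ᵤ⇒∣ d∣x))))

inverse-unique-mod : ∀ {n} x y y′ → x *ℤ y ≡ 1ℤ [mod n ] → x *ℤ y′ ≡ 1ℤ [mod n ] →
                     y ≡ y′ [mod n ]
inverse-unique-mod {n} x y y′ xy≡1 xy′≡1 = begin
  y               ≡⟨ ℤ.*-identityʳ y ⟨
  y *ℤ 1ℤ         ≈⟨ *-congˡ-mod y (x *ℤ y′) 1ℤ xy′≡1 ⟨
  y *ℤ (x *ℤ y′)  ≡⟨ identity x y y′ ⟩
  x *ℤ y *ℤ y′    ≈⟨ *-congʳ-mod y′ (x *ℤ y) 1ℤ xy≡1 ⟩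
  1ℤ *ℤ y′        ≡⟨ ℤ.*-identityˡ y′ ⟩
  y′              ∎
  where
  open ≡-mod-Reasoning n
  identity : ∀ x y y′ → y *ℤ (x *ℤ y′) ≡ x *ℤ y *ℤ y′
  identity = solve-∀

coprime⇒unit : ∀ {x} → (∀ n .{{_ : NonZero n}} → Coprime (seq x n) (+ n)) → x ∈ Ẑ*
coprime⇒unit {x} c = mkẐ y y-compatible , left , right
  where
  y : ∏ℤ/
  -- An explicit inverse modulo `n`, since `seq x n ^ (n !)` is 1 there.
  y n = seq x n ^ ℕ.pred (n !)

  right : ∀ n .{{_ : NonZero n}} → seq x n *ℤ y n ≡ 1ℤ [mod n ]
  right n = subst (λ k → seq x n ^ k ≡ 1ℤ [mod n ]) (sym (ℕ.suc-pred (n !) {{n ℕ.!≢0}}))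
    (coprime⇒^!≡1 (seq x n) n (c n))

  left : ∀ n .{{_ : NonZero n}} → y n *ℤ seq x n ≡ 1ℤ [mod n ]
  left n = subst (_≡ 1ℤ [mod n ]) (ℤ.*-comm (seq x n) (y n)) (right n)

  y-compatible : ∀ {m n} .{{_ : NonZero m}} .{{_ : NonZero n}} →
                 m ∣ n → y n ≡ y m [mod m ]
  -- The exponents in `y n` and `y m` differ, but both values invert `seq x m` modulo `m`.
  y-compatible {m} {n} m∣n = inverse-unique-mod (seq x m) (y n) (y m)
    (begin
      seq x m *ℤ y n  ≈⟨ *-congʳ-mod (y n) (seq x n) (seq x m) (compatible x m∣n) ⟨
      seq x n *ℤ y n  ≈⟨ ≡-mod-∣ (seq x n *ℤ y n) 1ℤ m∣n (right n) ⟩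
      1ℤ              ∎)
    (right m)
    where open ≡-mod-Reasoning m

-- A common divisor of `seq x n` and `n` other than 1 has a prime factor `p`. As `p ∣ n`,
-- compatibility carries the divisibility from coordinate `n` to coordinate `p`.
prime∤⇒unit : ∀ {x} → (∀ p .{{_ : NonZero p}} → Prime p → ¬ + p ∣ℤ seq x p) → x ∈ Ẑ*
prime∤⇒unit {x} p∤x = coprime⇒unit {x} coprime
  where
  coprime : ∀ n .{{_ : NonZero n}} → Coprime (seq x n) (+ n)
  coprime n {ℕ.zero} (_ , ℕ.divides q eq) = ⊥-elim (ℕ.≢-nonZero⁻¹ n (trans eq (ℕ.*-zeroʳ q)))
  coprime n {1}      _ = refl
  coprime n {d@(ℕ.2+ _)} (d∣x , d∣n) with prime-divisor d
  ... | p , pp , p∣d = ⊥-elim (p∤x p pp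
    (∣-resp-≡-mod (seq x n) (seq x p) (compatible x (ℕ.∣-trans p∣d d∣n))
      (∣ᵤ⇒∣ (ℕ.∣-trans p∣d d∣x))))
    where instance _ = prime⇒nonZero pp

-- In ℤ_q the powers b^(n!) tend to 0 if q ∣ b and to 1 otherwise, so this
-- point is a in ℤ_q for q ∣ b, and 1 in all other ℤ_q.
unitLift : ℤ → ℤ → Ẑ
unitLift a b = mkẐ (λ n → a + (1ℤ - a) *ℤ b ^ (n !)) λ {m} {n} m∣n →
  +-cong-mod a a ((1ℤ - a) *ℤ b ^ (n !)) ((1ℤ - a) *ℤ b ^ (m !)) (≡-mod-refl a)
    (*-congˡ-mod (1ℤ - a) (b ^ (n !)) (b ^ (m !)) (^!-stable b m m∣n))

∣⇒∣^! : ∀ {k b} n → k ∣ℤ b → k ∣ℤ b ^ (n !)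
∣⇒∣^! {k} {b} n k∣b =
  subst (λ e → k ∣ℤ b ^ e) (ℕ.suc-pred (n !) {{n ℕ.!≢0}})
    (∣m⇒∣m*n (b ^ ℕ.pred (n !)) k∣b)

-- The exponent `n !` is positive, so `b ^ (n !)` vanishes modulo every divisor of `b`, whatever the
-- coordinate `n`.
unitLift≡a : ∀ a b n .{{_ : NonZero n}} {m} → + m ∣ℤ b → seq (unitLift a b) n ≡ a [mod m ]
unitLift≡a a b n {m} m∣b =
  subst (+ m ∣ℤ_) (sym (i+j-i≡j a ((1ℤ - a) *ℤ b ^ (n !)))) (∣n⇒∣m*n (1ℤ - a) (∣⇒∣^! n m∣b))

-- It suffices to test primes `p`. If `p ∣ b`, the lift is `a` modulo `p`, and `p` cannot divide `a`
-- too; otherwise `b ^ (p !)` is 1 modulo `p`, and so is the lift.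
unitLift-unit : ∀ a b → Coprime a b → unitLift a b ∈ Ẑ*
unitLift-unit a b c = prime∤⇒unit {unitLift a b} p∤x
  where
  p∤x : ∀ p .{{_ : NonZero p}} → Prime p → ¬ + p ∣ℤ seq (unitLift a b) p
  p∤x p pp p∣x with p ℕ.∣? ∣ b ∣
  ... | yes p∣b = prime⇒≢1 pp
    (c (∣⇒∣ᵤ (∣-resp-≡-mod (seq (unitLift a b) p) a (unitLift≡a a b p (∣ᵤ⇒∣ p∣b)) p∣x) , p∣b))
  ... | no  p∤b = prime⇒≢1 pp
    (∣1⇒≡1 (∣⇒∣ᵤ (∣-resp-≡-mod (seq (unitLift a b) p) 1ℤ x≡1 p∣x)))
    where
    open ≡-mod-Reasoning p

    coprime : Coprime b (+ p)
    coprime (d∣b , d∣p) with prime⇒irreducible pp d∣p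
    ... | inj₁ d≡1  = d≡1
    ... | inj₂ refl = ⊥-elim (p∤b d∣b)

    identity : ∀ a → a + (1ℤ - a) *ℤ 1ℤ ≡ 1ℤ
    identity = solve-∀

    x≡1 : seq (unitLift a b) p ≡ 1ℤ [mod p ]
    x≡1 = begin
      a + (1ℤ - a) *ℤ b ^ (p !)
        ≈⟨ +-cong-mod a a ((1ℤ - a) *ℤ b ^ (p !)) ((1ℤ - a) *ℤ 1ℤ) (≡-mod-refl a)
             (*-congˡ-mod (1ℤ - a) (b ^ (p !)) 1ℤ (coprime⇒^!≡1 b p coprime)) ⟩
      a + (1ℤ - a) *ℤ 1ℤ
        ≡⟨ identity a ⟩
      1ℤ ∎

-- The closure of the primes in terms of congruences.

closure⇒prime-near : ∀ {x} → x ∈ closure 𝒫 → ∀ n .{{_ : NonZero n}} →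
                     ∃ λ p → Prime p × + p ≡ seq x n [mod n ]
closure⇒prime-near {x} x∈cl n
  with x∈cl (seq ⊢ V) (V , V-open , (λ v → v) , (λ v → v)) (≡-mod-refl (seq x n))
  where
  V : Pred ∏ℤ/ 0ℓ
  V f = f n ≡ seq x n [mod n ]

  V-open : ∏-Open V
  V-open f f∈V = n ∷ [] , λ g f≡g →
    ≡-mod-trans (g n) (f n) (seq x n) (≡-mod-sym (f n) (g n) (f≡g n (here refl))) f∈V
... | y , (p , pp , y≈p) , y∈V =
  p , pp , ≡-mod-trans (+ p) (seq y n) (seq x n) (≡-mod-sym (seq y n) (+ p) (y≈p n)) y∈V

-- The finitely many coordinates in `F` are controlled by the single modulus `sum F !`.
prime-near⇒closure : ∀ {x} → (∀ n .{{_ : NonZero n}} → ∃ λ p → Prime p × + p ≡ seq x n [mod n ]) →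
                     x ∈ closure 𝒫
prime-near⇒closure {x} near U (V , V-open , U⊆V , V⊆U) x∈U with V-open (seq x) (U⊆V x∈U)
... | F , F-nbhd with near (sum F !) {{sum F ℕ.!≢0}}
... | p , pp , p≡x =
  ι (+ p) , (p , pp , λ n → ≡-mod-refl (+ p)) , V⊆U (F-nbhd (λ _ → + p) x≡p)
  where
  instance
    N≢0 : NonZero (sum F !)
    N≢0 = sum F ℕ.!≢0

  x≡p : ∀ n .{{_ : NonZero n}} → n List.∈ F → seq x n ≡ + p [mod n ]
  x≡p n n∈F = begin
    seq x n           ≈⟨ compatible x (∈⇒∣sum! n∈F) ⟨
    seq x (sum F !)   ≈⟨ ≡-mod-∣ (+ p) (seq x (sum F !)) (∈⇒∣sum! n∈F) p≡x ⟨
    + p               ∎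
    where open ≡-mod-Reasoning n

prime∣prime⇒≡ : ∀ {p q} → Prime p → Prime q → p ∣ q → p ≡ q
prime∣prime⇒≡ pp qq p∣q with prime⇒irreducible qq p∣q
... | inj₁ p≡1 = ⊥-elim (prime⇒≢1 pp p≡1)
... | inj₂ p≡q = p≡q

-- The modulus `n * p` lets one prime `q` approximate `x` at both coordinates: at `p` it forces `q`
-- to be `p`, at `n` it gives the required congruence.
prime∣⇒≈ι : ∀ {x p} .{{_ : NonZero p}} → x ∈ closure 𝒫 → Prime p → + p ∣ℤ seq x p → x ≈ ι (+ p)
prime∣⇒≈ι {x} {p} x∈cl pp p∣x n =
  let q , qq , q≡x = closure⇒prime-near {x} x∈cl (n ℕ.* p) in
  subst (λ k → seq x n ≡ + k [mod n ])
    (sym (prime∣prime⇒≡ pp qq (∣⇒∣ᵤ {+ p} {+ q}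
      (∣-resp-≡-mod (seq x p) (+ q) (x≡ q q≡x (n∣m*n n)) p∣x))))
    (x≡ q q≡x (m∣m*n p))
  where
  instance
    np≢0 : NonZero (n ℕ.* p)
    np≢0 = ℕ.m*n≢0 n p

  x≡ : ∀ q {m} .{{_ : NonZero m}} → + q ≡ seq x (n ℕ.* p) [mod n ℕ.* p ] → m ∣ n ℕ.* p →
       seq x m ≡ + q [mod m ]
  x≡ q {m} q≡x m∣np = begin
    seq x m          ≈⟨ compatible x m∣np ⟨
    seq x (n ℕ.* p)  ≈⟨ ≡-mod-∣ (+ q) (seq x (n ℕ.* p)) m∣np q≡x ⟨
    + q              ∎
    where open ≡-mod-Reasoning m

-- The closure compared with `𝒫 ∪ Ẑ*`, and Dirichlet's theorem.

closure⊆𝒫∪Ẑ* : ExcludedMiddle 0ℓ → ∀ {x} → x ∈ closure 𝒫 → x ∈ 𝒫 ∪ Ẑ*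
closure⊆𝒫∪Ẑ* em {x} x∈cl
  -- Whether some prime divides `x` is a question about infinitely many coordinates, decided by
  -- excluded middle.
  with em {∃ λ p → Σ (Prime p) λ pp → + p ∣ℤ seq x p {{prime⇒nonZero pp}}}
... | yes (p , pp , p∣x) =
  inj₁ (p , pp , prime∣⇒≈ι {x} {{prime⇒nonZero pp}} x∈cl pp p∣x)
... | no none = inj₂ (prime∤⇒unit {x} λ p pp p∣x → none (p , pp , p∣x))

dirichlet⇒unit∈closure : ExcludedMiddle 0ℓ → DirichletTheorem → ∀ {x} → x ∈ Ẑ* → x ∈ closure 𝒫
dirichlet⇒unit∈closure em dirichlet {x} x∈Ẑ* = prime-near⇒closure {x} near
  where
  near : ∀ n .{{_ : NonZero n}} → ∃ λ p → Prime p × + p ≡ seq x n [mod n ]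
  -- `Infinite` is a negation: if the progression had no prime, the empty list would exhaust it.
  -- Double negation elimination then produces a prime.
  near n with em⇒dne em (λ none →
    dirichlet (seq x n) (+ n) (+≤+ (ℕ.>-nonZero⁻¹ n)) (unit⇒coprime {x} x∈Ẑ* n)
      ([] , λ {p} progression → ⊥-elim (none (p , progression))))
  ... | p , pp , k , eq = p , pp ,
    divides (+ k) (begin
      + p - seq x n                    ≡⟨ cong (_- seq x n) eq ⟩
      seq x n + + n *ℤ + k - seq x n   ≡⟨ i+j-i≡j (seq x n) (+ n *ℤ + k) ⟩
      + n *ℤ + k                       ≡⟨ ℤ.*-comm (+ n) (+ k) ⟩
      + k *ℤ + n                       ∎)
    where open ≡-Reasoning

-- The bound `a ≤ + p` makes the quotient `q` nonnegative, so its absolute value can serve as `k`.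
≡-mod⇒progression : ∀ {p a b} .{{_ : NonZero b}} → a ≤ + p → + p ≡ a [mod b ] →
                    ∃ λ (k : ℕ) → + p ≡ a + + b *ℤ + k
≡-mod⇒progression {p} {a} {b@(ℕ.suc _)} a≤p (divides q eq) = ∣ q ∣ , (begin
  + p                    ≡⟨ identity (+ p) a ⟩
  a + (+ p - a)          ≡⟨ cong (λ z → a + z) eq ⟩
  a + q *ℤ + b           ≡⟨ cong (λ z → a + z) (ℤ.*-comm q (+ b)) ⟩
  a + + b *ℤ q           ≡⟨ cong (λ z → a + + b *ℤ z) (ℤ.0≤i⇒+∣i∣≡i 0≤q) ⟨
  a + + b *ℤ + ∣ q ∣     ∎)
  where
  open ≡-Reasoning
  identity : ∀ p a → p ≡ a + (p - a)
  identity = solve-∀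

  0≤q : 0ℤ ≤ q
  0≤q = ℤ.*-cancelʳ-≤-pos 0ℤ q (+ b) (subst (0ℤ ≤_) eq (ℤ.i≤j⇒0≤j-i a≤p))

i≤∣i∣ : ∀ i → i ≤ + ∣ i ∣
i≤∣i∣ (+ n)        = ℤ.≤-refl
i≤∣i∣ -[1+ n ]     = -≤+

-- A prime p in the class of a unit modulo b K! does not divide K!, hence p > K;
-- K bounds both ∣ a ∣ and the members of the given finite list.
unit∈closure⇒dirichlet : (∀ {x} → x ∈ Ẑ* → x ∈ closure 𝒫) → DirichletTheorem
unit∈closure⇒dirichlet Ẑ*⊆closure a (+ ℕ.zero) (+≤+ ()) _
unit∈closure⇒dirichlet Ẑ*⊆closure a (+ b@(ℕ.suc _)) _ a⊥b (ps , all) =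
  let p , pp , p≡x = closure⇒prime-near {x} (Ẑ*⊆closure {x} x∈Ẑ*) N in
  -- The prime lies in the progression, so `all` places it in `ps`; as a member of the list summed
  -- in `K` it divides `K!`.
  p∤K! p≡x pp (∈⇒∣sum! {{prime⇒nonZero pp}} (there {x = ∣ a ∣}
    (all (pp , ≡-mod⇒progression (a≤p p≡x pp) (p≡a p≡x)))))
  where
  K K! N : ℕ
  K  = sum (∣ a ∣ ∷ ps)
  K! = K !
  N  = b ℕ.* K!

  instance
    N≢0 : NonZero N
    N≢0 = ℕ.m*n≢0 b K! {{_}} {{K ℕ.!≢0}}

  x : Ẑ
  x = unitLift a (+ b)

  x∈Ẑ* : x ∈ Ẑ*
  x∈Ẑ* = unitLift-unit a (+ b) a⊥b

  module _ {p : ℕ} (p≡x : + p ≡ seq x N [mod N ]) where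

    -- Otherwise `p` divides `N`, and the congruence modulo `N` makes it divide `seq x N`, which is
    -- coprime to `N`.
    p∤K! : Prime p → ¬ p ∣ K!
    p∤K! pp p∣K! = prime⇒≢1 pp
      (unit⇒coprime {x} x∈Ẑ* N (∣⇒∣ᵤ {+ p} {seq x N} p∣x , p∣N))
      where
      p∣N : p ∣ N
      p∣N = ℕ.∣-trans p∣K! (n∣m*n b)

      p∣x : + p ∣ℤ seq x N
      p∣x = ∣-resp-≡-mod (+ p) (seq x N) (≡-mod-∣ (+ p) (seq x N) p∣N p≡x) (∣ᵤ⇒∣ ℕ.∣-refl)

    a≤p : Prime p → a ≤ + p
    a≤p pp with ℕ.≤-total p ∣ a ∣
    ... | inj₂ ∣a∣≤p = ℤ.≤-trans (i≤∣i∣ a) (+≤+ ∣a∣≤p)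
    ... | inj₁ p≤∣a∣ = ⊥-elim (p∤K! pp (m≤n⇒m∣n! {{prime⇒nonZero pp}}
      (ℕ.≤-trans p≤∣a∣ (ℕ.m≤m+n ∣ a ∣ (sum ps)))))

    p≡a : + p ≡ a [mod b ]
    p≡a = ≡-mod-trans (+ p) (seq x N) a (≡-mod-∣ (+ p) (seq x N) (m∣m*n K!) p≡x)
      (unitLift≡a a (+ b) N (∣ᵤ⇒∣ ℕ.∣-refl))

dirichlet⇒𝒫∪Ẑ*⊆closure : ExcludedMiddle 0ℓ → DirichletTheorem → ∀ {x} → x ∈ 𝒫 ∪ Ẑ* → x ∈ closure 𝒫
dirichlet⇒𝒫∪Ẑ*⊆closure em dirichlet {x} (inj₁ x∈𝒫) U _ x∈U = x , x∈𝒫 , x∈U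
dirichlet⇒𝒫∪Ẑ*⊆closure em dirichlet {x} (inj₂ x∈Ẑ*) = dirichlet⇒unit∈closure em dirichlet {x} x∈Ẑ*

theorem3p27 : ExcludedMiddle 0ℓ → (DirichletTheorem ⇔ closure 𝒫 ≐ 𝒫 ∪ Ẑ*)
theorem3p27 em = mk⇔
  (λ dirichlet → (λ {x} → closure⊆𝒫∪Ẑ* em {x}) , (λ {x} → dirichlet⇒𝒫∪Ẑ*⊆closure em dirichlet {x}))
  (λ closure≐ → unit∈closure⇒dirichlet (λ {x} x∈Ẑ* → proj₂ closure≐ {x} (inj₂ x∈Ẑ*)))
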